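{- Let $A$ be a commutative ring, let $k\ge 1$, let $\vec s=(n_1,\dots,n_k)$ be a tuple of positive integers, and let $n=\min(n_1,\dots,n_k)-1$. Then the diagonal simplicial tensor module $X_\bullet(\vec s;A)$ is a strict algebraic $n$-hypergroupoid if and only if $k=n$.
   Context: Notation: $[p]=\{0,\dots,p\}$. For a shape $\vec s=(n_1,\dots,n_k)$ of positive integers with $n=\min(n_1,\dots,n_k)-1$, put $M_a(p)=n_a-1-n+p$ (so $M_a(p)\ge p$) and $I_p=\prod_{a=1}^k[M_a(p)]$ for $p\ge 0$. Let $\delta_i^q:[q-1]\to[q]$ be the increasing injection missing $i$ and $\sigma_i^q:[q+1]\to[q]$ the nondecreasing surjection taking the value $i$ twice. Define $\Delta_i^p=\prod_{a=1}^k\delta_i^{M_a(p)}:I_{p-1}\to I_p$ ($p\ge1$, $0\le i\le p$) and $\Sigma_i^p=\prod_{a=1}^k\sigma_i^{M_a(p)}:I_{p+1}\to I_p$ ($p\ge 0$, $0\le i\le p$). The diagonal simplicial tensor module $X_\bullet(\vec s;A)$ is the simplicial $A$-module with $X_p=A^{I_p}$ (all functions $T:I_p\to A$), faces $d_i^p(T)=T\circ\Delta_i^p$ and degeneracies $s_i^p(T)=T\circ\Sigma_i^p$. For a simplicial $A$-module $X_\bullet$ and $0\le j\le p$, the horn kernel is the submodule $R_{p,j}(X)=\bigcap_{i\in[p]\setminus\{j\}}\ker(d_i^p:X_p\to X_{p-1})$ of $X_p$ (for $p=0$ the empty intersection is $R_{0,0}(X)=X_0$). A simplicial module $X_\bullet$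 is a strict algebraic $n$-hypergroupoid if (1) $R_{p,j}(X)=0$ for all $p>n$ and all $j$, and (2) $R_{n,j}(X)\ne0$ for at least one $j$.
   Formalization: The commutative ring A is assumed to be nontrivial (1 ≠ 0); over the zero ring every horn kernel vanishes, so the claim fails whenever k = n. -}

module Defs where

open import Algebra.Bundles using (CommutativeRing)
open import Algebra.Module.Bundles using (Module)
open import Algebra.Module.Morphism.Structures using (module ModuleMorphisms)
open import Algebra.Module.Structures.Biased using (IsModuleFromLeft)
import Algebra.Construct.Pointwise as Pointwise
open import Data.Fin.Base using (Fin; zero; suc; inject₁; punchIn; pinch; _↑ˡ_; _≤_; _<_)
open import Data.Fin.Properties using (toℕ-↑ˡ)
open import Data.Nat.Base as ℕ using (ℕ; zero; suc; _+_; _∸_; _⊓_; NonZero; z≤n; s≤s)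
open import Data.Product.Base using (_×_; _,_; ∃)
open import Data.Unit.Polymorphic.Base using (⊤)
open import Data.Vec.Base using (Vec; foldr₁)
open import Data.Vec.Relation.Unary.All as All using (All; []; _∷_)
open import Function.Base using (_∘_)
open import Level using (Level; _⊔_) renaming (suc to lsuc)
open import Relation.Binary.PropositionalEquality.Core
  using (_≡_; _≢_; refl; sym; cong; cong₂; subst; subst₂)
open import Relation.Nullary.Negation.Core using (¬_)
open import Relation.Unary using (Pred; _≐_)

private
  variable
    r ℓ m ℓm : Level

-- Over the zero ring every horn kernel vanishes, so no simplicial module
-- is a strict algebraic hypergroupoid; hence 1 ≠ 0 has to be assumed.

Nontrivial : CommutativeRing r ℓ → Set ℓ
Nontrivial A = ¬ (1# ≈ 0#)
  where open CommutativeRing A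

-- The simplicial identities are reindexed so as to avoid predecessors on
-- Fin: a condition "i < j" with j ≥ 1 becomes "i ≤ j" with suc j in place
-- of j, and similarly for "i > j + 1".

record SimplicialModule (A : CommutativeRing r ℓ) (m ℓm : Level)
                        : Set (r ⊔ ℓ ⊔ lsuc (m ⊔ ℓm)) where
  field
    X : ℕ → Module A m ℓm

  module X p = Module (X p)

  field
    d : ∀ {p} → Fin (suc (suc p)) → X.Carrierᴹ (suc p) → X.Carrierᴹ p
    s : ∀ {p} → Fin (suc p) → X.Carrierᴹ p → X.Carrierᴹ (suc p)

    d-linear : ∀ {p} (i : Fin (suc (suc p))) →
      ModuleMorphisms.IsModuleHomomorphism
        (X.rawModule (suc p)) (X.rawModule p) (d i)
    s-linear : ∀ {p} (i : Fin (suc p)) →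
      ModuleMorphisms.IsModuleHomomorphism
        (X.rawModule p) (X.rawModule (suc p)) (s i)

    d-d : ∀ {p} {i j : Fin (suc (suc p))} → i ≤ j → ∀ x →
      X._≈ᴹ_ p (d i (d (suc j) x)) (d j (d (inject₁ i) x))
    s-s : ∀ {p} {i j : Fin (suc p)} → i ≤ j → ∀ x →
      X._≈ᴹ_ (suc (suc p)) (s (inject₁ i) (s j x)) (s (suc j) (s i x))
    d-s-< : ∀ {p} {i : Fin (suc (suc p))} {j : Fin (suc p)} →
      i ≤ inject₁ j → ∀ x →
      X._≈ᴹ_ (suc p) (d (inject₁ i) (s (suc j) x)) (s j (d i x))
    d-s-≡ : ∀ {p} (j : Fin (suc p)) x → X._≈ᴹ_ p (d (inject₁ j) (s j x)) x
    d-s-suc : ∀ {p} (j : Fin (suc p)) x → X._≈ᴹ_ p (d (suc j) (s j x)) x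
    d-s-> : ∀ {p} {i : Fin (suc (suc p))} {j : Fin (suc p)} →
      inject₁ j < i → ∀ x →
      X._≈ᴹ_ (suc p) (d (suc i) (s (inject₁ j) x)) (s j (d i x))

module _ {A : CommutativeRing r ℓ} (𝑿 : SimplicialModule A m ℓm) where
  open SimplicialModule 𝑿

  HornKernel : ∀ p → Fin (suc p) → Pred (X.Carrierᴹ p) ℓm
  HornKernel zero    _ _ = ⊤
  HornKernel (suc p) j x = ∀ i → i ≢ j → X._≈ᴹ_ p (d i x) (X.0ᴹ p)

  HornKernelIsZero : ∀ p → Fin (suc p) → Set (m ⊔ ℓm)
  HornKernelIsZero p j = HornKernel p j ≐ (λ x → X._≈ᴹ_ p x (X.0ᴹ p))

  IsStrictAlgebraicHypergroupoid : ℕ → Set (m ⊔ ℓm)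
  IsStrictAlgebraicHypergroupoid n =
      (∀ p → n ℕ.< p → ∀ j → HornKernelIsZero p j)
    × (∃ λ j → ¬ HornKernelIsZero n j)

functionModule : (A : CommutativeRing r ℓ) (I : Set) → Module A r ℓ
functionModule A I = record
  { Carrierᴹ = I → Carrier
  ; _≈ᴹ_     = λ f g → ∀ x → f x ≈ g x
  ; _+ᴹ_     = λ f g x → f x +ᴬ g x
  ; _*ₗ_     = λ a f x → a * f x
  ; _*ᵣ_     = λ f a x → a * f x
  ; 0ᴹ       = λ _ → 0#
  ; -ᴹ_      = λ f x → - f x
  ; isModule = IsModuleFromLeft.isModule {commutativeRing = A} record
    { isLeftModule = record
      { isLeftSemimodule = record
        { +ᴹ-isCommutativeMonoid =
            Pointwise.isCommutativeMonoid I +-isCommutativeMonoid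
        ; isPreleftSemimodule = record
          { *ₗ-cong      = λ a≈b f≈g x → *-cong a≈b (f≈g x)
          ; *ₗ-zeroˡ     = λ f x → zeroˡ (f x)
          ; *ₗ-distribʳ  = λ f a b x → distribʳ (f x) a b
          ; *ₗ-identityˡ = λ f x → *-identityˡ (f x)
          ; *ₗ-assoc     = λ a b f x → *-assoc a b (f x)
          ; *ₗ-zeroʳ     = λ a x → zeroʳ a
          ; *ₗ-distribˡ  = λ a f g x → distribˡ a (f x) (g x)
          }
        }
      ; -ᴹ‿cong    = λ f≈g x → -‿cong (f≈g x)
      ; -ᴹ‿inverse = (λ f x → -‿inverseˡ (f x)) , (λ f x → -‿inverseʳ (f x))
      }
    }
  }
  where open CommutativeRing A renaming (_+_ to _+ᴬ_)

module _ (A : CommutativeRing r ℓ) {I J : Set} (φ : I → J) where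
  open CommutativeRing A using () renaming (refl to ≈-refl)

  precompose-linear :
    ModuleMorphisms.IsModuleHomomorphism
      (Module.rawModule (functionModule A J))
      (Module.rawModule (functionModule A I)) (_∘ φ)
  precompose-linear = record
    { isBimoduleHomomorphism = record
      { +ᴹ-isGroupHomomorphism = record
        { isMonoidHomomorphism = record
          { isMagmaHomomorphism = record
            { isRelHomomorphism = record { cong = λ f≈g x → f≈g (φ x) }
            ; homo = λ _ _ _ → ≈-refl
            }
          ; ε-homo = λ _ → ≈-refl
          }
        ; ⁻¹-homo = λ _ _ → ≈-refl
        }
      ; *ₗ-homo = λ _ _ _ → ≈-refl
      ; *ᵣ-homo = λ _ _ _ → ≈-refl
      }
    }

private
  δδ : ∀ {n} {i j : Fin (suc n)} → i ≤ j → ∀ x →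
    punchIn (suc j) (punchIn i x) ≡ punchIn (inject₁ i) (punchIn j x)
  δδ {i = zero}                _         x       = refl
  δδ {i = suc i} {j = suc j}   _         zero    = refl
  δδ {i = suc i} {j = suc j}   (s≤s i≤j) (suc x) = cong suc (δδ i≤j x)

  σσ : ∀ {n} {i j : Fin n} → i ≤ j → ∀ x →
    pinch j (pinch (inject₁ i) x) ≡ pinch i (pinch (suc j) x)
  σσ {suc n} {zero}  {zero}  _         zero          = refl
  σσ {suc n} {zero}  {suc j} _         zero          = refl
  σσ {suc n} {suc i} {suc j} _         zero          = refl
  σσ {suc n} {zero}  {j}     _         (suc zero)    = pinch-zero j
    where
    pinch-zero : ∀ {n} (j : Fin (suc n)) → pinch j zero ≡ zero
    pinch-zero zero    = refl
    pinch-zero (suc j) = refl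
  σσ {suc n} {zero}  {j}     _         (suc (suc x)) = refl
  σσ {suc n} {suc i} {suc j} (s≤s i≤j) (suc x)       = cong suc (σσ i≤j x)

  σδ-< : ∀ {n} {i : Fin (suc n)} {j : Fin n} → i ≤ inject₁ j → ∀ x →
    pinch (suc j) (punchIn (inject₁ i) x) ≡ punchIn i (pinch j x)
  σδ-< {suc n} {zero}  {j}     _         x       = refl
  σδ-< {suc n} {suc i} {suc j} _         zero    = refl
  σδ-< {suc n} {suc i} {suc j} (s≤s i≤j) (suc x) = cong suc (σδ-< i≤j x)

  σδ-≡ : ∀ {n} (j : Fin n) x → pinch j (punchIn (inject₁ j) x) ≡ x
  σδ-≡ {suc n} zero    x       = refl
  σδ-≡ {suc n} (suc j) zero    = refl
  σδ-≡ {suc n} (suc j) (suc x) = cong suc (σδ-≡ j x)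

  σδ-suc : ∀ {n} (j : Fin n) x → pinch j (punchIn (suc j) x) ≡ x
  σδ-suc {suc n} zero    zero    = refl
  σδ-suc {suc n} zero    (suc x) = refl
  σδ-suc {suc n} (suc j) zero    = refl
  σδ-suc {suc n} (suc j) (suc x) = cong suc (σδ-suc j x)

  σδ-> : ∀ {n} {i : Fin (suc n)} {j : Fin n} → inject₁ j < i → ∀ x →
    pinch (inject₁ j) (punchIn (suc i) x) ≡ punchIn i (pinch j x)
  σδ-> {suc n} {suc i} {zero}  _         zero    = refl
  σδ-> {suc n} {suc i} {zero}  _         (suc x) = refl
  σδ-> {suc n} {suc i} {suc j} _         zero    = refl
  σδ-> {suc n} {suc i} {suc j} (s≤s j<i) (suc x) = cong suc (σδ-> j<i x)

  inject₁-↑ˡ : ∀ {n} (i : Fin n) c → inject₁ i ↑ˡ c ≡ inject₁ (i ↑ˡ c)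
  inject₁-↑ˡ zero    c = refl
  inject₁-↑ˡ (suc i) c = cong suc (inject₁-↑ˡ i c)

  ↑ˡ-≤ : ∀ {n} {i j : Fin n} c → i ≤ j → i ↑ˡ c ≤ j ↑ˡ c
  ↑ˡ-≤ {i = i} {j} c = subst₂ ℕ._≤_ (sym (toℕ-↑ˡ i c)) (sym (toℕ-↑ˡ j c))

  ↑ˡ-< : ∀ {n} {i j : Fin n} c → i < j → i ↑ˡ c < j ↑ˡ c
  ↑ˡ-< {i = i} {j} c = subst₂ ℕ._<_ (sym (toℕ-↑ˡ i c)) (sym (toℕ-↑ˡ j c))

  module _ {n : ℕ} (c : ℕ) where

    δδ↑ : ∀ {i j : Fin (suc n)} → i ≤ j → ∀ x →
      punchIn (suc j ↑ˡ c) (punchIn (i ↑ˡ c) x) ≡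
      punchIn (inject₁ i ↑ˡ c) (punchIn (j ↑ˡ c) x)
    δδ↑ {i} i≤j x rewrite inject₁-↑ˡ i c = δδ (↑ˡ-≤ c i≤j) x

    σσ↑ : ∀ {i j : Fin n} → i ≤ j → ∀ x →
      pinch (j ↑ˡ c) (pinch (inject₁ i ↑ˡ c) x) ≡
      pinch (i ↑ˡ c) (pinch (suc j ↑ˡ c) x)
    σσ↑ {i} i≤j x rewrite inject₁-↑ˡ i c = σσ (↑ˡ-≤ c i≤j) x

    σδ-<↑ : ∀ {i : Fin (suc n)} {j : Fin n} → i ≤ inject₁ j → ∀ x →
      pinch (suc j ↑ˡ c) (punchIn (inject₁ i ↑ˡ c) x) ≡
      punchIn (i ↑ˡ c) (pinch (j ↑ˡ c) x)
    σδ-<↑ {i} {j} i≤j x rewrite inject₁-↑ˡ i c =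
      σδ-< (subst (i ↑ˡ c ≤_) (inject₁-↑ˡ j c) (↑ˡ-≤ c i≤j)) x

    σδ-≡↑ : ∀ (j : Fin n) x →
      pinch (j ↑ˡ c) (punchIn (inject₁ j ↑ˡ c) x) ≡ x
    σδ-≡↑ j x rewrite inject₁-↑ˡ j c = σδ-≡ (j ↑ˡ c) x

    σδ->↑ : ∀ {i : Fin (suc n)} {j : Fin n} → inject₁ j < i → ∀ x →
      pinch (inject₁ j ↑ˡ c) (punchIn (suc i ↑ˡ c) x) ≡
      punchIn (i ↑ˡ c) (pinch (j ↑ˡ c) x)
    σδ->↑ {i} {j} j<i x rewrite inject₁-↑ˡ j c =
      σδ-> (subst (_< i ↑ˡ c) (inject₁-↑ˡ j c) (↑ˡ-< c j<i)) x

  map-∘-≡ : ∀ {k} {P Q Q′ R : ℕ → Set} {v : Vec ℕ k}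
    {f : ∀ {a} → Q a → R a} {g : ∀ {a} → P a → Q a}
    {f′ : ∀ {a} → Q′ a → R a} {g′ : ∀ {a} → P a → Q′ a} →
    (∀ {a} x → f {a} (g x) ≡ f′ (g′ x)) → (t : All P v) →
    All.map f (All.map g t) ≡ All.map f′ (All.map g′ t)
  map-∘-≡ eq []      = refl
  map-∘-≡ eq (x ∷ t) = cong₂ _∷_ (eq x) (map-∘-≡ eq t)

  map-∘-id : ∀ {k} {P Q : ℕ → Set} {v : Vec ℕ k}
    {f : ∀ {a} → Q a → P a} {g : ∀ {a} → P a → Q a} →
    (∀ {a} x → f {a} (g x) ≡ x) → (t : All P v) →
    All.map f (All.map g t) ≡ t
  map-∘-id eq []      = refl
  map-∘-id eq (x ∷ t) = cong₂ _∷_ (eq x) (map-∘-id eq t)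

minimum : ∀ {k} .{{_ : NonZero k}} → Vec ℕ k → ℕ
minimum {suc k} = foldr₁ _⊓_

shapeDim : ∀ {k} .{{_ : NonZero k}} → Vec ℕ k → ℕ
shapeDim v = minimum v ∸ 1

module Diagonal {k : ℕ} .{{_ : NonZero k}} (v : Vec ℕ k) where

  -- For an entry a of v, the truncated subtractions are exact when all
  -- entries are positive. The summand p comes first so that
  -- M a (suc p) reduces to suc (M a p).

  excess : ℕ → ℕ
  excess a = a ∸ 1 ∸ shapeDim v

  M : ℕ → ℕ → ℕ
  M a p = p + excess a

  -- All is used as a heterogeneous product because, unlike
  -- dependent functions, its elements are equal when they agree
  -- componentwise, so that every function on Index p is extensional.

  Index : ℕ → Set
  Index p = All (λ a → Fin (suc (M a p))) v

  -- i ↑ˡ excess a is the number i ∈ [p] viewed in [M a p].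

  Δ : ∀ {p} → Fin (suc (suc p)) → Index p → Index (suc p)
  Δ i = All.map (λ {a} → punchIn (i ↑ˡ excess a))

  Σ : ∀ {p} → Fin (suc p) → Index (suc p) → Index p
  Σ i = All.map (λ {a} → pinch (i ↑ˡ excess a))

  private
    ΔΔ : ∀ {p} {i j : Fin (suc (suc p))} → i ≤ j → ∀ t →
      Δ (suc j) (Δ i t) ≡ Δ (inject₁ i) (Δ j t)
    ΔΔ i≤j = map-∘-≡ λ {a} → δδ↑ (excess a) i≤j

    ΣΣ : ∀ {p} {i j : Fin (suc p)} → i ≤ j → ∀ t →
      Σ j (Σ (inject₁ i) t) ≡ Σ i (Σ (suc j) t)
    ΣΣ i≤j = map-∘-≡ λ {a} → σσ↑ (excess a) i≤j

    ΣΔ-< : ∀ {p} {i : Fin (suc (suc p))} {j : Fin (suc p)} →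
      i ≤ inject₁ j → ∀ t → Σ (suc j) (Δ (inject₁ i) t) ≡ Δ i (Σ j t)
    ΣΔ-< i≤j = map-∘-≡ λ {a} → σδ-<↑ (excess a) i≤j

    ΣΔ-≡ : ∀ {p} (j : Fin (suc p)) t → Σ j (Δ (inject₁ j) t) ≡ t
    ΣΔ-≡ j = map-∘-id λ {a} → σδ-≡↑ (excess a) j

    ΣΔ-suc : ∀ {p} (j : Fin (suc p)) t → Σ j (Δ (suc j) t) ≡ t
    ΣΔ-suc j = map-∘-id λ {a} → σδ-suc (j ↑ˡ excess a)

    ΣΔ-> : ∀ {p} {i : Fin (suc (suc p))} {j : Fin (suc p)} →
      inject₁ j < i → ∀ t → Σ (inject₁ j) (Δ (suc i) t) ≡ Δ i (Σ j t)
    ΣΔ-> j<i = map-∘-≡ λ {a} → σδ->↑ (excess a) j<i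

  diagonal : (A : CommutativeRing r ℓ) → SimplicialModule A r ℓ
  diagonal A = record
    { X        = λ p → functionModule A (Index p)
    ; d        = λ i T → T ∘ Δ i
    ; s        = λ i T → T ∘ Σ i
    ; d-linear = λ i → precompose-linear A (Δ i)
    ; s-linear = λ i → precompose-linear A (Σ i)
    ; d-d      = λ i≤j T t → reflexive (cong T (ΔΔ i≤j t))
    ; s-s      = λ i≤j T t → reflexive (cong T (ΣΣ i≤j t))
    ; d-s-<    = λ i≤j T t → reflexive (cong T (ΣΔ-< i≤j t))
    ; d-s-≡    = λ j T t → reflexive (cong T (ΣΔ-≡ j t))
    ; d-s-suc  = λ j T t → reflexive (cong T (ΣΔ-suc j t))
    ; d-s->    = λ j<i T t → reflexive (cong T (ΣΔ-> j<i t))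
    }
    where open CommutativeRing A using (reflexive)

open Diagonal public using (diagonal)

{-# OPTIONS --safe #-}

-- A tensor T ∈ X_p lies in the horn kernel R_{p,j} iff it vanishes on every
-- index having no coordinate equal to some i ∈ [p] ∖ {j}, since the image of
-- Δ_i consists of the indices avoiding the value i. So R_{p,j} is the space of
-- tensors supported on the indices whose coordinates cover [p] ∖ {j}. As all
-- these p values are admissible in each of the k coordinates, such an index
-- exists iff p ≤ k, whence R_{p,j} = 0 iff k < p, independently of j.

module Submission where

open import Defs
open import Algebra.Bundles using (CommutativeRing)
open import Data.Bool.Base using (if_then_else_)
open import Data.Fin.Base using (Fin; zero; suc; toℕ; punchIn; punchOut; splitAt; _↑ˡ_)
open import Data.Fin.Properties
  using (all?; injective⇒≤; punchIn-injective; punchIn-punchOut; punchInᵢ≢i;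
         splitAt-↑ˡ; toℕ-injective; toℕ-↑ˡ; ¬∀⟶∃¬)
open import Data.Nat.Base as ℕ using (ℕ; zero; suc; _+_; NonZero)
open import Data.Nat.Properties
  using (≤-antisym; ≤-reflexive; ≤-<-trans; <⇒≱; ≮⇒≥; m≤n⇒∃[o]m+o≡n; _≟_)
open import Data.Product.Base using (_,_; ∃; map)
open import Data.Sum.Base using ([_,_]′)
open import Data.Vec.Base using (Vec; []; _∷_; lookup; tabulate)
open import Data.Vec.Membership.DecPropositional _≟_ using (_∈_; _∉_; _∈?_)
open import Data.Vec.Membership.Propositional.Properties using (∈-tabulate⁺)
open import Data.Vec.Relation.Unary.All as All using (All; []; _∷_)
open import Data.Vec.Relation.Unary.Any using (here; there; index)
open import Data.Vec.Relation.Unary.Any.Properties using (lookup-index)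
open import Function.Base using (_∘_; const)
open import Function.Bundles using (_⇔_; mk⇔)
open import Level using (Level)
open import Relation.Binary.PropositionalEquality
  using (_≡_; _≢_; refl; sym; trans; cong; cong₂; subst; ≢-sym)
open import Relation.Nullary.Decidable
  using (Dec; does; dec-true; dec-false)
open import Relation.Nullary.Negation using (¬_; contradiction)

module _ (e : ℕ → ℕ) {p : ℕ} where

  -- `e` stays arbitrary because `excess` depends on the whole shape, which would change in a
  -- recursion on `v`. Passing to `ℕ` makes entries with different bounds comparable.
  coordinates : ∀ {k} {v : Vec ℕ k} → All (λ a → Fin (suc (p + e a))) v → Vec ℕ k
  coordinates = All.reduce toℕ

  coordinates-surjective : ∀ {k} (v : Vec ℕ k) (f : Fin k → Fin (suc p)) →
    ∃ λ (t : All (λ a → Fin (suc (p + e a))) v) →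
    coordinates t ≡ tabulate (toℕ ∘ f)
  coordinates-surjective []      f = [] , refl
  coordinates-surjective (a ∷ v) f with coordinates-surjective v (f ∘ suc)
  ... | t , eq = (f zero ↑ˡ e a) ∷ t , cong₂ _∷_ (toℕ-↑ˡ (f zero) (e a)) eq

module _ (e : ℕ → ℕ) {p : ℕ} (i : Fin (suc (suc p))) where

  -- For `e = excess` this is `Δ i` definitionally.
  punchIns : ∀ {k} {v : Vec ℕ k} →
    All (λ a → Fin (suc (p + e a))) v → All (λ a → Fin (suc (suc p + e a))) v
  punchIns = All.map (λ {a} → punchIn (i ↑ˡ e a))

  punchIns-avoids : ∀ {k} {v : Vec ℕ k} (t : All (λ a → Fin (suc (p + e a))) v) →
    toℕ i ∉ coordinates e {suc p} (punchIns t)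
  punchIns-avoids {v = a ∷ _} (x ∷ t) (here eq) =
    punchInᵢ≢i (i ↑ˡ e a) x
      (toℕ-injective (trans (sym eq) (sym (toℕ-↑ˡ i (e a)))))
  punchIns-avoids (x ∷ t) (there i∈t) = punchIns-avoids t i∈t

  avoids⇒punchIns : ∀ {k} {v : Vec ℕ k}
    (t : All (λ a → Fin (suc (suc p + e a))) v) →
    toℕ i ∉ coordinates e {suc p} t → ∃ λ u → punchIns u ≡ t
  avoids⇒punchIns []                  _   = [] , refl
  avoids⇒punchIns {v = a ∷ _} (x ∷ t) i∉ =
    map (punchOut i≢x ∷_) (cong₂ _∷_ (punchIn-punchOut i≢x))
        (avoids⇒punchIns t (i∉ ∘ there))
    where
    i≢x : i ↑ˡ e a ≢ x
    i≢x eq = i∉ (here (trans (sym (toℕ-↑ˡ i (e a))) (cong toℕ eq)))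

module _ {p : ℕ} (j : Fin (suc p)) where

  -- `punchIn j` enumerates the elements of `[p]` other than `j` by `Fin p`, so that the counting
  -- below compares exactly `p` values with `k` positions.
  Covers : ∀ {k} → Vec ℕ k → Set
  Covers xs = ∀ q → toℕ (punchIn j q) ∈ xs

  covers? : ∀ {k} (xs : Vec ℕ k) → Dec (Covers xs)
  covers? xs = all? λ q → toℕ (punchIn j q) ∈? xs

  -- Pigeonhole: sending `q` to a position where `punchIn j q` occurs is injective, since the entry
  -- at that position determines `q`.
  covers⇒≤ : ∀ {k} {xs : Vec ℕ k} → Covers xs → p ℕ.≤ k
  covers⇒≤ {xs = xs} cov = injective⇒≤ λ {q} {q′} eq →
    punchIn-injective j q q′ (toℕ-injective
      (trans (lookup-index (cov q))
        (trans (cong (lookup xs) eq) (sym (lookup-index (cov q′))))))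

  ≤⇒∃covers : ∀ {k} → p ℕ.≤ k →
    ∃ λ (f : Fin k → Fin (suc p)) → Covers (tabulate (toℕ ∘ f))
  ≤⇒∃covers p≤k with m≤n⇒∃[o]m+o≡n p≤k
  ... | o , refl = f , λ q →
    subst (_∈ tabulate (toℕ ∘ f))
      (cong (toℕ ∘ [ punchIn j , const j ]′) (splitAt-↑ˡ p q o))
      (∈-tabulate⁺ (toℕ ∘ f) (q ↑ˡ o))
    where
    f : Fin (p + o) → Fin (suc p)
    -- The first `p` positions already cover; the other `o` are padded with the default `j`.
    f = [ punchIn j , const j ]′ ∘ splitAt p

module _ {r ℓ : Level} (A : CommutativeRing r ℓ)
         {k : ℕ} .{{_ : NonZero k}} (v : Vec ℕ k) where

  open CommutativeRing A
    using (Carrier; _≈_; 0#; 1#; reflexive) renaming (trans to ≈-trans; sym to ≈-sym)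
  open Diagonal v using (Index; excess; Δ)

  horn-kernel-zero : ∀ {p} → k ℕ.< p → ∀ j → HornKernelIsZero (diagonal v A) p j
  horn-kernel-zero {suc p} k<p j = (λ {T} → vanishes T) , λ T≈0 i i≢j t → T≈0 (Δ i t)
    where
    vanishes : ∀ T → HornKernel (diagonal v A) (suc p) j T → ∀ t → T t ≈ 0#
    vanishes T T∈R t
      -- Decidable membership turns the failure to cover into an explicit omitted `q`.
      with ¬∀⟶∃¬ _ _ (λ q → toℕ (punchIn j q) ∈? coordinates excess t)
             (λ cov → <⇒≱ k<p (covers⇒≤ j cov))
    ... | q , q∉t with avoids⇒punchIns excess (punchIn j q) t q∉t
    -- Now `t` is `Δ i u` with `i = punchIn j q`, so `T t` is the value at `u` of a face of `T` that
    -- vanishes because `i ≢ j`.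
    ... | u , refl = T∈R (punchIn j q) (punchInᵢ≢i j q) u

  module _ {p : ℕ} (j : Fin (suc p)) where

    -- Taking all covering indices at once separates membership in the horn kernel from the
    -- existence of a cover, which is where `p ≤ k` enters.
    coverIndicator : Index p → Carrier
    coverIndicator t = if does (covers? j (coordinates excess t)) then 1# else 0#

    coverIndicator-covers : ∀ t → Covers j (coordinates excess t) → coverIndicator t ≡ 1#
    coverIndicator-covers t cov =
      cong (if_then 1# else 0#) (dec-true (covers? j (coordinates excess t)) cov)

    coverIndicator-¬covers : ∀ t → ¬ Covers j (coordinates excess t) → coverIndicator t ≡ 0#
    coverIndicator-¬covers t ¬cov =
      cong (if_then 1# else 0#) (dec-false (covers? j (coordinates excess t)) ¬cov)

  -- `Δ i t` omits `i`, but a covering index must contain it as `i ≢ j`; `punchOut j≢i` is the place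
  -- of `i` in the enumeration by `punchIn j`.
  coverIndicator∈R : ∀ p j → HornKernel (diagonal v A) p j (coverIndicator j)
  coverIndicator∈R zero    j = _
  coverIndicator∈R (suc p) j i i≢j t = reflexive (coverIndicator-¬covers j (Δ i t)
    λ cov → punchIns-avoids excess i t
      (subst (λ i′ → toℕ i′ ∈ coordinates excess (Δ i t)) (punchIn-punchOut j≢i)
        (cov (punchOut j≢i))))
    where
    j≢i = ≢-sym i≢j

  -- Were the kernel zero, the indicator would vanish at a covering index, where its value is `1#`.
  horn-kernel-nonzero : Nontrivial A → ∀ {p} → p ℕ.≤ k → ∀ j →
    ¬ HornKernelIsZero (diagonal v A) p j
  horn-kernel-nonzero 1≉0 {p} p≤k j (R⊆0 , _) with ≤⇒∃covers j p≤k
  ... | f , cov with coordinates-surjective excess v f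
  ... | t , eq = 1≉0 (≈-trans
    (≈-sym (reflexive (coverIndicator-covers j t (subst (Covers j) (sym eq) cov))))
    (R⊆0 (coverIndicator∈R p j) t))

theorem5p3 : {r ℓ : Level} (A : CommutativeRing r ℓ) → Nontrivial A →
    (k : ℕ) .{{_ : NonZero k}} (v : Vec ℕ k) → All NonZero v →
    IsStrictAlgebraicHypergroupoid (diagonal v A) (shapeDim v) ⇔ k ≡ shapeDim v
theorem5p3 A 1≉0 k v _ = mk⇔
  (λ { (zero-above , j , nonzero) → ≤-antisym
    -- If `n < k`, the vanishing above `n` already fails at level `k`, the last level with a cover.
    (≮⇒≥ λ n<k → horn-kernel-nonzero A v 1≉0 (≤-reflexive refl) zero
                   (zero-above k n<k zero))
    (≮⇒≥ λ k<n → nonzero (horn-kernel-zero A v k<n j)) })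
  (λ k≡n →
    (λ p n<p → horn-kernel-zero A v (≤-<-trans (≤-reflexive k≡n) n<p)) ,
    zero , horn-kernel-nonzero A v 1≉0 (≤-reflexive (sym k≡n)) zero)
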